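{- Let $G$ be a median graph and $v_0$ a vertex of $G$. For any LexBFS ordering of the vertices of $G$ started at $v_0$, with parent map $f$, and for any edge $uv$ of $G$ with $v_0\notin\{u,v\}$, the parents $f(u)$ and $f(v)$ are adjacent.
   Context: All graphs are finite, simple, connected and undirected; $d(u,v)$ is the shortest-path distance and $I(u,v)=\{x: d(u,x)+d(x,v)=d(u,v)\}$. $G$ is a median graph if for every triple $x,y,z$ of vertices $I(x,y)\cap I(y,z)\cap I(z,x)$ is a single vertex. Breadth-first search (BFS) from $v_0$ uses a queue; it defines a total order $<$ on vertices (order of insertion into the queue); when a vertex $u$ is removed from the head of the queue, all its not yet discovered neighbors $v$ are inserted and $u$ becomes the parent $f(v)$ of $v$. For $v\neq v_0$, the predecessors of $v$ are its neighbors $u$ with $d(v_0,u)<d(v_0,v)$, and $f(v)$ is the $<$-smallest predecessor. Lexicographic BFS (LexBFS) is the refinement of BFS in which ties among vertices are broken as follows: the list of already-ordered neighbors (predecessors) of each vertex is sorted by $<$, and a vertex is visited earlier than another if its sorted predecessor list is lexicographically smaller (comparing earliest predecessors first, then second-earliest, etc., where a vertex having an additional predecessor at the first position where the lists differ—the other list having ended—is chosen first). A LexBFS ordering is the resulting total order $<$ with its parent map $f$. -}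

module Defs where

open import Data.Nat using (ℕ; zero; suc; _+_; _<_; _≤_)
open import Data.Fin using (Fin; toℕ)
open import Data.Product using (Σ; ∃; _×_; _,_)
open import Data.Sum using (_⊎_)
open import Relation.Nullary using (¬_)
open import Relation.Binary.PropositionalEquality using (_≡_; _≢_)
open import Function.Definitions using (Injective)

record Graph : Set₁ where
  field
    n     : ℕ
    _~_   : Fin n → Fin n → Set
    ~-sym : ∀ {u v} → u ~ v → v ~ u
    ~-irr : ∀ {u} → ¬ (u ~ u)

  data Walk : Fin n → Fin n → ℕ → Set where
    here : ∀ {u} → Walk u u zero
    step : ∀ {u w v k} → u ~ w → Walk w v k → Walk u v (suc k)

  Dist : Fin n → Fin n → ℕ → Set
  Dist u v k = Walk u v k × (∀ m → Walk u v m → k ≤ m)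

  Connected : Set
  Connected = ∀ u v → ∃ λ k → Walk u v k

  InInterval : Fin n → Fin n → Fin n → Set
  InInterval u v x = ∃ λ a → ∃ λ b → ∃ λ k →
    Dist u x a × Dist x v b × Dist u v k × a + b ≡ k

  IsMedian : Set
  IsMedian = ∀ x y z →
    Σ (Fin n) λ m →
      (InInterval x y m × InInterval y z m × InInterval z x m) ×
      (∀ m' → InInterval x y m' → InInterval y z m' → InInterval z x m' → m' ≡ m)

  module BFS (v₀ : Fin n) (pos : Fin n → Fin n) where

    _<ₒ_ : Fin n → Fin n → Set
    x <ₒ y = toℕ (pos x) < toℕ (pos y)

    _≤ₒ_ : Fin n → Fin n → Set
    x ≤ₒ y = toℕ (pos x) ≤ toℕ (pos y)

    Pred : Fin n → Fin n → Set
    Pred u v = u ~ v × ∃ λ a → ∃ λ b → Dist v₀ u a × Dist v₀ v b × a < b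

    -- Sorted predecessor list of v is lexicographically ≤ that of w
    -- in the LexBFS sense (v is chosen no later than w). Comparing the
    -- <ₒ-sorted lists, the first difference is at the <ₒ-smallest vertex p
    -- of the symmetric difference; v wins iff p is a predecessor of v
    -- (either p is smaller than w's entry there, or w's list has ended).
    LexPrefer : Fin n → Fin n → Set
    LexPrefer v w =
      (∀ q → (Pred q v → Pred q w) × (Pred q w → Pred q v))
      ⊎ (∃ λ p → Pred p v × ¬ Pred p w ×
           (∀ q → q <ₒ p → (Pred q v → Pred q w) × (Pred q w → Pred q v)))

    IsLexBFS : Set
    IsLexBFS =
      Injective _≡_ _≡_ pos ×
      toℕ (pos v₀) ≡ 0 ×
      (∀ v w → v <ₒ w → ∀ a b → Dist v₀ v a → Dist v₀ w b →
         a < b ⊎ (a ≡ b × LexPrefer v w))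

    IsParent : Fin n → Fin n → Set
    IsParent p v = Pred p v × (∀ q → Pred q v → p ≤ₒ q)

{-# OPTIONS --safe #-}
-- An edge joins consecutive distance levels, so let t cover b and put a = f t; if a ≠ b,
-- then f b has to be the meet x of a and b.  Induct on the level of t.  If y = f b ≠ x, then
-- f a and y have a common upper neighbour c below t.  As a precedes c and y precedes x,
-- LexBFS provides the first predecessor p of a that is not one of c, and the first
-- predecessor s of y that is not one of x; here p precedes y, and s precedes the meet r of
-- p and x.  If f s = f r, then t covers some e above p whose parent is a predecessor of c
-- preceding p but not of a, against the choice of p.  If f s ≠ f r, then f a, f p, f x, f r,
-- f s form the configuration u, h, b, r, s of "descent", which passes from vertices to their
-- parents and hence would descend for ever.
module Submission where

open import Defs
open import Data.Empty using (⊥)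
open import Data.Fin using (Fin; toℕ)
open import Data.Fin.Properties using (_≟_; toℕ-injective)
open import Data.Nat using (ℕ; zero; suc; _+_; _<_; _≤_; z≤n; s≤s; s≤s⁻¹)
open import Data.Nat.Properties
  using (≤-reflexive; ≤-trans; ≤-antisym; ≤∧≢⇒<; ≰⇒>; <-irrefl; <-trans; ≤-<-trans;
         <⇒≤; <⇒≱; <-cmp; n<1+n; suc-injective; +-comm; +-identityʳ; +-cancelʳ-≡;
         m≢1+n+m; m≤n⇒m<n∨m≡n)
open import Data.Product using (∃; _×_; _,_; proj₁; proj₂)
open import Data.Sum using (inj₁; inj₂)
open import Function using (_∘_)
open import Relation.Binary.Definitions using (Tri; tri<; tri≈; tri>)
open import Relation.Binary.PropositionalEquality
  using (_≡_; _≢_; refl; sym; trans; cong; cong₂; subst; subst₂; ≢-sym)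
open import Relation.Nullary using (Dec; ¬_; yes; no; contradiction)

-- Arithmetic of the three distances to a median

pairwise-sum-2 : ∀ a b c → a + b ≡ 2 → b + c ≡ 2 → c + a ≡ 2 → a ≡ 1 × b ≡ 1 × c ≡ 1
pairwise-sum-2 0 _ 0 refl _ ()
pairwise-sum-2 0 _ (suc _) refl () _
pairwise-sum-2 1 _ _ refl refl _ = refl , refl , refl
pairwise-sum-2 2 _ _ refl refl ()

equal-sum-2 : ∀ a b c → a + b ≡ 2 → c + a ≡ b + c → a ≡ 1 × b ≡ 1
equal-sum-2 a b c a+b≡2 eq with +-cancelʳ-≡ c a b (trans (+-comm a c) eq)
equal-sum-2 1 _ _ _ _ | refl = refl , refl
equal-sum-2 0 _ _ () _ | refl
equal-sum-2 2 _ _ () _ | refl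
equal-sum-2 (suc (suc (suc _))) _ _ () _ | refl

odd-perimeter : ∀ a b c → a + b ≡ 1 → b + c ≢ c + a
odd-perimeter 0 1 c refl eq = m≢1+n+m c {0} (trans (sym (+-identityʳ c)) (sym eq))
odd-perimeter 1 0 c refl eq = m≢1+n+m c {0} (trans eq (+-comm c 1))
odd-perimeter (suc (suc _)) _ _ () _

-- Distances and medians

module Median (G : Graph) (med : Graph.IsMedian G) where
  open Graph G

  V : Set
  V = Fin n

  _++ʷ_ : ∀ {x y z k l} → Walk x y k → Walk y z l → Walk x z (k + l)
  here ++ʷ w = w
  step e v ++ʷ w = step e (v ++ʷ w)

  reverseʷ : ∀ {x y k} → Walk x y k → Walk y x k
  reverseʷ here = here
  reverseʷ {k = suc k} (step e w) =
    subst (Walk _ _) (+-comm k 1) (reverseʷ w ++ʷ step (~-sym e) here)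

  -- Adjacency comes without a decision procedure, so shortest walks are not searched for: an
  -- interval witness already contains the distance between its ends.
  distance : ∀ x y → ∃ (Dist x y)
  distance x y with med x y x
  ... | _ , ((_ , _ , k , _ , _ , dist , _) , _) , _ = k , dist

  d : V → V → ℕ
  d x y = proj₁ (distance x y)

  geodesic : ∀ x y → Walk x y (d x y)
  geodesic x y = proj₁ (proj₂ (distance x y))

  d-minimal : ∀ {x y k} → Walk x y k → d x y ≤ k
  d-minimal {x} {y} = proj₂ (proj₂ (distance x y)) _

  d-unique : ∀ {x y k} → Dist x y k → k ≡ d x y
  d-unique (w , least) = ≤-antisym (least _ (geodesic _ _)) (d-minimal w)

  d-sym : ∀ x y → d x y ≡ d y x
  d-sym x y = ≤-antisym (d-minimal (reverseʷ (geodesic y x))) (d-minimal (reverseʷ (geodesic x y)))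

  d-refl : ∀ x → d x x ≡ 0
  d-refl x = ≤-antisym (d-minimal here) z≤n

  d≡0 : ∀ {x y} → d x y ≡ 0 → x ≡ y
  d≡0 {x} {y} eq with d x y | geodesic x y
  d≡0 refl | _ | here = refl

  d≡1 : ∀ {x y} → d x y ≡ 1 → x ~ y
  d≡1 {x} {y} eq with d x y | geodesic x y
  d≡1 refl | _ | step e here = e

  ~⇒d≡1 : ∀ {x y} → x ~ y → d x y ≡ 1
  ~⇒d≡1 e = ≤-antisym (d-minimal (step e here))
    (≰⇒> λ d≤0 → ~-irr (subst (_~ _) (d≡0 (≤-antisym d≤0 z≤n)) e))

  common-neighbour⇒d≡2 : ∀ {x y z} → x ~ y → y ~ z → x ≢ z → ¬ x ~ z → d x z ≡ 2
  common-neighbour⇒d≡2 {x} {z = z} xy yz x≢z x≁z =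
    exact (d x z) (d-minimal (step xy (step yz here))) (x≢z ∘ d≡0) (x≁z ∘ d≡1)
    where
    exact : ∀ k → k ≤ 2 → k ≢ 0 → k ≢ 1 → k ≡ 2
    exact 0 _ k≢0 _ = contradiction refl k≢0
    exact 1 _ _ k≢1 = contradiction refl k≢1
    exact 2 _ _ _ = refl
    exact (suc (suc (suc _))) (s≤s (s≤s ())) _ _

  Between : V → V → V → Set
  Between x y m = d m x + d m y ≡ d x y

  interval⇒between : ∀ {x y m} → InInterval x y m → Between x y m
  interval⇒between {x} {y} {m} (_ , _ , _ , xm , my , xy , eq) =
    trans (cong (_+ d m y) (d-sym m x))
      (subst₂ _≡_ (cong₂ _+_ (d-unique xm) (d-unique my)) (d-unique xy) eq)

  between⇒interval : ∀ {x y m} → Between x y m → InInterval x y m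
  between⇒interval {x} {y} {m} eq =
    _ , _ , _ , proj₂ (distance x m) , proj₂ (distance m y) , proj₂ (distance x y) ,
    trans (cong (_+ d m y) (d-sym x m)) eq

  median : ∀ x y z → ∃ λ m → Between x y m × Between y z m × Between z x m
  median x y z with med x y z
  ... | m , (xy , yz , zx) , _ = m , interval⇒between xy , interval⇒between yz , interval⇒between zx

  -- A common neighbour of two vertices at distance 2 lies in their interval, so `p` and `q` are
  -- both medians of `x`, `y`, `z`.
  K₂₃-free : ∀ {x y z p q} → d x y ≡ 2 → d y z ≡ 2 → d z x ≡ 2 →
    p ~ x → p ~ y → p ~ z → q ~ x → q ~ y → q ~ z → p ≡ q
  K₂₃-free {x} {y} {z} xy yz zx px py pz qx qy qz with med x y z
  ... | _ , _ , unique =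
    trans (unique _ (mid px py xy) (mid py pz yz) (mid pz px zx))
      (sym (unique _ (mid qx qy xy) (mid qy qz yz) (mid qz qx zx)))
    where
    mid : ∀ {u v m} → m ~ u → m ~ v → d u v ≡ 2 → InInterval u v m
    mid mu mv eq = between⇒interval (trans (cong₂ _+_ (~⇒d≡1 mu) (~⇒d≡1 mv)) (sym eq))

  -- Levels, meets and joins around the base vertex

  module Levels (v₀ : V) where

    lv : V → ℕ
    lv x = d x v₀

    infix 4 _⋗_
    -- The covering relation of the order based at `v₀`; it is `Pred` with the arguments swapped.
    _⋗_ : V → V → Set
    x ⋗ y = x ~ y × lv x ≡ suc (lv y)

    lv-step : ∀ {x y} → x ~ y → lv x ≤ suc (lv y)
    lv-step {y = y} e = d-minimal (step e (geodesic y v₀))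

    -- Bipartiteness: the median of `x`, `y`, `v₀` would be an end of the edge `x y`, which forces
    -- the levels of the ends to differ by one.
    same-level⇒≁ : ∀ {x y} → lv x ≡ lv y → ¬ x ~ y
    same-level⇒≁ {x} {y} eq e with median x y v₀
    ... | m , xmy , ymv₀ , v₀mx = odd-perimeter (d m x) (d m y) (d m v₀)
      (trans xmy (~⇒d≡1 e)) (trans ymv₀ (trans (sym eq) (trans (d-sym x v₀) (sym v₀mx))))

    ~⇒⋗ : ∀ {x y} → x ~ y → lv y < lv x → x ⋗ y
    ~⇒⋗ e y<x = e , ≤-antisym (lv-step e) y<x

    ⋗-levelˡ : ∀ {x y z} → x ⋗ y → x ⋗ z → lv y ≡ lv z
    ⋗-levelˡ (_ , xy) (_ , xz) = suc-injective (trans (sym xy) xz)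

    ⋗-levelʳ : ∀ {x y z} → x ⋗ z → y ⋗ z → lv x ≡ lv y
    ⋗-levelʳ (_ , xz) (_ , yz) = trans xz (sym yz)

    ⋗-level² : ∀ {x y z a b} → x ⋗ a → a ⋗ y → x ⋗ b → b ⋗ z → lv y ≡ lv z
    ⋗-level² xa (_ , ay) xb (_ , bz) =
      suc-injective (trans (sym ay) (trans (⋗-levelˡ xa xb) bz))

    ⋗⇒≢v₀ : ∀ {x y} → x ⋗ y → x ≢ v₀
    ⋗⇒≢v₀ (_ , eq) refl with () ← trans (sym (d-refl v₀)) eq

    ≢⇒≢v₀ : ∀ {x y} → x ≢ y → lv x ≡ lv y → x ≢ v₀
    ≢⇒≢v₀ x≢y eq refl = x≢y (sym (d≡0 (trans (sym eq) (d-refl v₀))))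

    ⋗-d₂ : ∀ {x y z} → x ⋗ y → y ⋗ z → d x z ≡ 2
    ⋗-d₂ {x} {z = z} (xy , lx) (yz , ly) = common-neighbour⇒d≡2 xy yz
      (λ { refl → too-far (<⇒≤ (n<1+n (lv z))) }) (too-far ∘ lv-step)
      where
      too-far : ¬ lv x ≤ suc (lv z)
      too-far le = <⇒≱ (n<1+n (suc (lv z))) (subst (_≤ suc (lv z)) (trans lx (cong suc ly)) le)

    lower-d₂ : ∀ {x y z} → x ⋗ y → x ⋗ z → y ≢ z → d y z ≡ 2
    lower-d₂ xy xz y≢z = common-neighbour⇒d≡2 (~-sym (proj₁ xy)) (proj₁ xz) y≢z
      (same-level⇒≁ (⋗-levelˡ xy xz))

    upper-d₂ : ∀ {x y z} → x ⋗ z → y ⋗ z → x ≢ y → d x y ≡ 2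
    upper-d₂ xz yz x≢y = common-neighbour⇒d≡2 (proj₁ xz) (~-sym (proj₁ yz)) x≢y
      (same-level⇒≁ (⋗-levelʳ xz yz))

    -- The median of `y`, `z`, `v₀`: as `y` and `z` are on one level and at distance 2, it is
    -- adjacent to both, and lies below them.
    meet : ∀ {x y z} → x ⋗ y → x ⋗ z → y ≢ z → ∃ λ w → y ⋗ w × z ⋗ w
    meet {x} {y} {z} xy xz y≢z with median y z v₀
    ... | w , ywz , zwv₀ , v₀wy
      with w~y , w~z ← equal-sum-2 (d w y) (d w z) (lv w)
             (trans ywz (lower-d₂ xy xz y≢z))
             (trans v₀wy (trans (d-sym v₀ y) (trans (⋗-levelˡ xy xz) (sym zwv₀))))
      = w ,
        (~-sym (d≡1 w~y) ,
          trans (d-sym y v₀) (trans (sym v₀wy) (trans (cong (lv w +_) w~y) (+-comm (lv w) 1)))) ,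
        (~-sym (d≡1 w~z) , trans (sym zwv₀) (cong (_+ lv w) w~z))

    -- The median of `x`, `y`, `z`, which are pairwise at distance 2. The vertices `a` and `b`
    -- witness this for the pairs with `x`, and `w` for `y`, `z`.
    join : ∀ {x a b y z w} → x ⋗ a → a ⋗ y → x ⋗ b → b ⋗ z → y ⋗ w → z ⋗ w → y ≢ z →
      ∃ λ m → x ⋗ m × m ⋗ y × m ⋗ z
    join {x} {a} {y = y} {z} xa ay xb bz yw zw y≢z with median x y z
    ... | m , xmy , ymz , zmx
      with m~x , m~y , m~z ← pairwise-sum-2 (d m x) (d m y) (d m z)
             (trans xmy (⋗-d₂ xa ay))
             (trans ymz (upper-d₂ yw zw y≢z))
             (trans zmx (trans (d-sym z x) (⋗-d₂ xb bz)))
      = m , (~-sym (d≡1 m~x) , trans lx (cong suc (sym lm))) , (d≡1 m~y , lm) ,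
        (d≡1 m~z , trans lm (cong suc (⋗-levelʳ yw zw)))
      where
      lx : lv x ≡ suc (suc (lv y))
      lx = trans (proj₂ xa) (cong suc (proj₂ ay))
      lm : lv m ≡ suc (lv y)
      lm = ≤-antisym (lv-step (d≡1 m~y)) (s≤s⁻¹ (subst (_≤ suc (lv m)) lx (lv-step (~-sym (d≡1 m~x)))))

    -- Two meets would give `x`, `w`, `w′` the two common neighbours `y` and `z`.
    meet-unique : ∀ {x y z w w′} → x ⋗ y → x ⋗ z → y ≢ z →
      y ⋗ w → z ⋗ w → y ⋗ w′ → z ⋗ w′ → w ≡ w′
    meet-unique {w = w} {w′} (xy , lx) (xz , lx′) y≢z yw zw yw′ zw′ with w ≟ w′
    ... | yes eq = eq
    ... | no w≢w′ = contradiction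
      (K₂₃-free (⋗-d₂ (xy , lx) yw) (lower-d₂ yw yw′ w≢w′)
        (trans (d-sym w′ _) (⋗-d₂ (xy , lx) yw′))
        (~-sym xy) (proj₁ yw) (proj₁ yw′) (~-sym xz) (proj₁ zw) (proj₁ zw′))
      y≢z

    join-unique : ∀ {x x′ y z w} → x ⋗ y → x ⋗ z → x′ ⋗ y → x′ ⋗ z →
      y ⋗ w → z ⋗ w → y ≢ z → x ≡ x′
    join-unique {x} {x′} xy xz x′y x′z yw zw y≢z with x ≟ x′
    ... | yes eq = eq
    ... | no x≢x′ = contradiction
      (K₂₃-free (⋗-d₂ xy yw) (trans (d-sym _ x′) (⋗-d₂ x′y yw)) (upper-d₂ x′y xy (≢-sym x≢x′))
        (~-sym (proj₁ xy)) (proj₁ yw) (~-sym (proj₁ x′y))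
        (~-sym (proj₁ xz)) (proj₁ zw) (~-sym (proj₁ x′z)))
      y≢z

    -- Otherwise `x` and `w` are common neighbours of the three vertices between them, hence equal,
    -- although two levels apart.
    no-common-lower : ∀ {x y₁ y₂ y₃ w} → x ⋗ y₁ → x ⋗ y₂ → x ⋗ y₃ → y₁ ≢ y₂ → y₂ ≢ y₃ → y₃ ≢ y₁ →
      y₁ ⋗ w → y₂ ⋗ w → ¬ y₃ ⋗ w
    no-common-lower x1 x2 x3 1≢2 2≢3 3≢1 1w 2w 3w
      with refl ← K₂₃-free (lower-d₂ x1 x2 1≢2) (lower-d₂ x2 x3 2≢3) (lower-d₂ x3 x1 3≢1)
                    (proj₁ x1) (proj₁ x2) (proj₁ x3)
                    (~-sym (proj₁ 1w)) (~-sym (proj₁ 2w)) (~-sym (proj₁ 3w))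
      = m≢1+n+m _ {1} (trans (proj₂ x1) (cong suc (proj₂ 1w)))

    -- Order properties of LexBFS parents

    module LexBFS (pos : V → V) (lexBFS : BFS.IsLexBFS v₀ pos) (f : V → V)
                  (parent : ∀ v → v ≢ v₀ → BFS.IsParent v₀ pos (f v) v) where
      open BFS v₀ pos

      Pred⇒⋗ : ∀ {x y} → Pred y x → x ⋗ y
      Pred⇒⋗ {x} {y} (e , _ , _ , dy , dx , y<x) =
        ~⇒⋗ (~-sym e) (subst₂ _<_ (trans (d-unique dy) (d-sym v₀ y)) (trans (d-unique dx) (d-sym v₀ x)) y<x)

      ⋗⇒Pred : ∀ {x y} → x ⋗ y → Pred y x
      ⋗⇒Pred {x} {y} (e , eq) = ~-sym e , _ , _ , proj₂ (distance v₀ y) , proj₂ (distance v₀ x) ,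
        ≤-reflexive (trans (cong suc (d-sym v₀ y)) (trans (sym eq) (d-sym x v₀)))

      <ₒ⇒≢ : ∀ {x y} → x <ₒ y → x ≢ y
      <ₒ⇒≢ x<y refl = <-irrefl refl x<y

      ≤ₒ∧≢⇒<ₒ : ∀ {x y} → x ≤ₒ y → x ≢ y → x <ₒ y
      ≤ₒ∧≢⇒<ₒ x≤y x≢y = ≤∧≢⇒< x≤y (x≢y ∘ proj₁ lexBFS ∘ toℕ-injective)

      f-⋗ : ∀ {x} → x ≢ v₀ → x ⋗ f x
      f-⋗ x≢v₀ = Pred⇒⋗ (proj₁ (parent _ x≢v₀))

      f-least : ∀ {x y} → x ⋗ y → f x ≤ₒ y
      f-least xy = proj₂ (parent _ (⋗⇒≢v₀ xy)) _ (⋗⇒Pred xy)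

      lexPrefer : ∀ {v w} → v <ₒ w → lv v ≡ lv w → LexPrefer v w
      lexPrefer {v} {w} v<w eq
        with proj₂ (proj₂ lexBFS) v w v<w _ _ (proj₂ (distance v₀ v)) (proj₂ (distance v₀ w))
      ... | inj₁ lt = contradiction (trans (d-sym v₀ v) (trans eq (d-sym w v₀))) (λ e → <-irrefl e lt)
      ... | inj₂ (_ , prefer) = prefer

      -- The parent heads the sorted predecessor list, and the earlier vertex has the
      -- lexicographically preferred list.
      f-mono : ∀ {v w} → v <ₒ w → lv v ≡ lv w → w ≢ v₀ → f v ≤ₒ f w
      f-mono {v} {w} v<w eq w≢v₀ with lexPrefer v<w eq
      ... | inj₁ same = f-least (Pred⇒⋗ (proj₂ (same (f w)) (⋗⇒Pred (f-⋗ w≢v₀))))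
      ... | inj₂ (p , vp , _ , agree) with <-cmp (toℕ (pos (f w))) (toℕ (pos p))
      ...   | tri< fw<p _ _ = f-least (Pred⇒⋗ (proj₂ (agree (f w) fw<p) (⋗⇒Pred (f-⋗ w≢v₀))))
      ...   | tri≈ _ fw≡p _ = ≤-trans (f-least (Pred⇒⋗ vp)) (≤-reflexive (sym fw≡p))
      ...   | tri> _ _ p<fw = ≤-trans (f-least (Pred⇒⋗ vp)) (<⇒≤ p<fw)

      f-reflect-< : ∀ {v w} → f v <ₒ f w → lv v ≡ lv w → v ≢ v₀ → v <ₒ w
      f-reflect-< {v} {w} fv<fw eq v≢v₀ with <-cmp (toℕ (pos v)) (toℕ (pos w))
      ... | tri< v<w _ _ = v<w
      ... | tri≈ _ v≡w _ = contradiction (cong f (proj₁ lexBFS (toℕ-injective v≡w))) (<ₒ⇒≢ fv<fw)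
      ... | tri> _ _ w<v = contradiction (f-mono w<v (sym eq) v≢v₀) (<⇒≱ fv<fw)

      -- Since `q` is on one list only, the lists differ, and `v` owns the first difference; `q` is
      -- another difference, so it comes later.
      first-difference : ∀ {v w q} → v <ₒ w → lv v ≡ lv w → w ⋗ q → ¬ v ⋗ q →
        ∃ λ p → v ⋗ p × ¬ w ⋗ p × p <ₒ q × (∀ {m} → m <ₒ p → w ⋗ m → v ⋗ m)
      first-difference {q = q} v<w eq wq v⋗̸q with lexPrefer v<w eq
      ... | inj₁ same = contradiction (Pred⇒⋗ (proj₂ (same q) (⋗⇒Pred wq))) v⋗̸q
      ... | inj₂ (p , vp , w⋗̸p , agree) =
        p , Pred⇒⋗ vp , w⋗̸p ∘ ⋗⇒Pred , p<q ,
        λ {m} m<p wm → Pred⇒⋗ (proj₂ (agree m m<p) (⋗⇒Pred wm))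
        where
        p<q : p <ₒ q
        p<q with <-cmp (toℕ (pos p)) (toℕ (pos q))
        ... | tri< lt _ _ = lt
        ... | tri≈ _ p≡q _ =
          contradiction (subst (_ ⋗_) (proj₁ lexBFS (toℕ-injective p≡q)) (Pred⇒⋗ vp)) v⋗̸q
        ... | tri> _ _ q<p = contradiction (Pred⇒⋗ (proj₂ (agree q q<p) (⋗⇒Pred wq))) v⋗̸q

      -- Induction step at level `N`

      module Step (N : ℕ) (IH : ∀ {x y} → lv x < N → x ⋗ y → y ≢ v₀ → f x ⋗ f y) where

        below : ∀ {x y} → lv x < N → x ⋗ y → lv y < N
        below {x} {y} x<N (_ , eq) = <-trans (subst (lv y <_) (sym eq) (n<1+n (lv y))) x<N

        -- Passing to parents reproduces the configuration one level lower, which is impossible at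
        -- level 0; `l` makes the recursion structural. The last hypothesis keeps `f u` from
        -- covering `s`.
        descent : ∀ l {u h b r s} → lv u ≡ l → lv u < N →
          u ⋗ h → u ⋗ b → h ⋗ r → b ⋗ r → b ⋗ s → h <ₒ b → s <ₒ r →
          (∀ {k} → u ⋗ k → k ⋗ s → ¬ k <ₒ h) → ⊥
        descent zero lu _ (_ , lu′) _ _ _ _ _ _ _ with () ← trans (sym lu) lu′
        descent (suc l) {u} {h} {b} {r} {s} lu u<N uh ub hr br bs h<b s<r none =
          descent l (suc-injective (trans (sym (proj₂ ug)) lu)) (below u<N ug)
            g-fh g-fb fh-fr fb-fr fb-fs fh<fb fs<fr none′
          where
          g : V
          g = f u
          h≢b : h ≢ b
          h≢b = <ₒ⇒≢ h<b
          s≢r : s ≢ r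
          s≢r = <ₒ⇒≢ s<r
          h≢v₀ : h ≢ v₀
          h≢v₀ = ⋗⇒≢v₀ hr
          b≢v₀ : b ≢ v₀
          b≢v₀ = ⋗⇒≢v₀ br
          ug : u ⋗ g
          ug = f-⋗ (⋗⇒≢v₀ uh)
          g-fb : g ⋗ f b
          g-fb = IH u<N ub b≢v₀
          g-fh : g ⋗ f h
          g-fh = IH u<N uh h≢v₀
          b-fb : b ⋗ f b
          b-fb = f-⋗ b≢v₀
          fb<r : f b <ₒ r
          fb<r = ≤-<-trans (f-least bs) s<r
          h⋗̸fb : ¬ h ⋗ f b
          h⋗̸fb h-fb = <ₒ⇒≢ fb<r (meet-unique uh ub h≢b h-fb b-fb hr br)
          -- `g` covers `f b`, but `h` does not: `f b` would be a second meet of `h` and `b` besides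
          -- `r`.
          g<h : g <ₒ h
          g<h = ≤ₒ∧≢⇒<ₒ (f-least uh) (λ g≡h → h⋗̸fb (subst (_⋗ f b) g≡h g-fb))
          g⋗̸s : ¬ g ⋗ s
          g⋗̸s gs = none ug gs g<h
          fb≢s : f b ≢ s
          fb≢s fb≡s = g⋗̸s (subst (g ⋗_) fb≡s g-fb)
          s≢v₀ : s ≢ v₀
          s≢v₀ = ≢⇒≢v₀ s≢r (⋗-levelˡ bs br)
          r≢v₀ : r ≢ v₀
          r≢v₀ = ≢⇒≢v₀ (≢-sym s≢r) (⋗-levelˡ br bs)
          fb-fs : f b ⋗ f s
          fb-fs = IH (below u<N ub) bs s≢v₀
          fb-fr : f b ⋗ f r
          fb-fr = IH (below u<N ub) br r≢v₀
          fh-fr : f h ⋗ f r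
          fh-fr = IH (below u<N uh) hr r≢v₀
          fh<fb : f h <ₒ f b
          fh<fb = ≤ₒ∧≢⇒<ₒ (f-mono h<b (⋗-levelˡ uh ub) b≢v₀)
            (λ fh≡fb → h⋗̸fb (subst (h ⋗_) fh≡fb (f-⋗ h≢v₀)))
          fs<fr : f s <ₒ f r
          fs<fr = ≤ₒ∧≢⇒<ₒ (f-mono s<r (⋗-levelˡ bs br) r≢v₀)
            (λ fs≡fr → no-common-lower bs br b-fb s≢r (≢-sym (<ₒ⇒≢ fb<r)) fb≢s
              (f-⋗ s≢v₀) (subst (r ⋗_) (sym fs≡fr) (f-⋗ r≢v₀)) fb-fs)
          -- Such a `k` lifts to some `k′` between `u` and `s` with parent `k`; as `f` reflects
          -- strict order, `k′` would precede `h`, against `none`.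
          none′ : ∀ {k} → g ⋗ k → k ⋗ f s → ¬ k <ₒ f h
          none′ {k} gk k-fs k<fh
            with k′ , uk′ , k′k , k′s ← join ug gk ub bs k-fs (f-⋗ s≢v₀) (λ { refl → g⋗̸s gk })
            = none uk′ k′s (f-reflect-< (subst (_<ₒ f h) (sym fk′≡k) k<fh) (⋗-levelˡ uk′ uh) (⋗⇒≢v₀ k′k))
            where
            fk′≡k : f k′ ≡ k
            fk′≡k = meet-unique ug uk′ (λ g≡k′ → g⋗̸s (subst (_⋗ s) (sym g≡k′) k′s))
              (IH u<N uk′ (⋗⇒≢v₀ k′k)) (f-⋗ (⋗⇒≢v₀ k′k)) gk k′k

        lower-<N : ∀ {t y} → lv t ≡ N → t ⋗ y → lv y < N
        lower-<N {y = y} lt (_ , eq) = subst (lv y <_) (trans (sym eq) lt) (n<1+n (lv y))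

        meet-is-parent : ∀ {t b x} → lv t ≡ N → t ⋗ b → f t ≢ b → f t ⋗ x → b ⋗ x → ¬ f b ≢ x
        meet-is-parent {t} {b} {x} lt tb a≢b ax bx y≢x = with-c (join ta a-p′ tb by p′z yz p′≢y)
          where
          a y p′ z : V
          a = f t
          y = f b
          p′ = f a
          z = f x
          ta : t ⋗ a
          ta = f-⋗ (⋗⇒≢v₀ tb)
          a<N : lv a < N
          a<N = lower-<N lt ta
          b<N : lv b < N
          b<N = lower-<N lt tb
          by : b ⋗ y
          by = f-⋗ (⋗⇒≢v₀ bx)
          y<x : y <ₒ x
          y<x = ≤ₒ∧≢⇒<ₒ (f-least bx) y≢x
          a⋗̸y : ¬ a ⋗ y
          a⋗̸y ay = y≢x (meet-unique ta tb a≢b ay by ax bx)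
          a-p′ : a ⋗ p′
          a-p′ = f-⋗ (⋗⇒≢v₀ ax)
          p′≢y : p′ ≢ y
          p′≢y p′≡y = a⋗̸y (subst (a ⋗_) p′≡y a-p′)
          x≢v₀ : x ≢ v₀
          x≢v₀ = ≢⇒≢v₀ (≢-sym y≢x) (⋗-levelˡ bx by)
          y≢v₀ : y ≢ v₀
          y≢v₀ = ≢⇒≢v₀ y≢x (⋗-levelˡ by bx)
          xz : x ⋗ z
          xz = f-⋗ x≢v₀
          -- The induction hypothesis along the edges `a x` and `b x` places `z` below both `p′` and
          -- `y`, as the join `c` requires.
          p′z : p′ ⋗ z
          p′z = IH a<N ax x≢v₀
          yz : y ⋗ z
          yz = IH b<N bx x≢v₀

          with-c : ∃ (λ c → t ⋗ c × c ⋗ p′ × c ⋗ y) → ⊥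
          with-c (c , tc , cp′ , cy) = with-p (first-difference a<c (⋗-levelˡ ta tc) cy a⋗̸y)
            where
            c<N : lv c < N
            c<N = lower-<N lt tc
            a≢c : a ≢ c
            a≢c a≡c = a⋗̸y (subst (_⋗ y) (sym a≡c) cy)
            a<c : a <ₒ c
            a<c = ≤ₒ∧≢⇒<ₒ (f-least tc) a≢c
            ∧-ac : ∀ {m} → a ⋗ m → c ⋗ m → m ≡ p′
            ∧-ac am cm = meet-unique ta tc a≢c am cm a-p′ cp′

            with-p : ∃ (λ p → a ⋗ p × ¬ c ⋗ p × p <ₒ y × (∀ {m} → m <ₒ p → c ⋗ m → a ⋗ m)) → ⊥
            with-p (p , ap , c⋗̸p , p<y , agree) = with-r (meet ap ax (<ₒ⇒≢ p<x))
              where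
              h : V
              h = f p
              p<x : p <ₒ x
              p<x = <-trans p<y y<x
              p≢v₀ : p ≢ v₀
              p≢v₀ = ≢⇒≢v₀ (<ₒ⇒≢ p<x) (⋗-levelˡ ap ax)
              p′≢p : p′ ≢ p
              p′≢p p′≡p = c⋗̸p (subst (c ⋗_) p′≡p cp′)
              p′<p : p′ <ₒ p
              p′<p = ≤ₒ∧≢⇒<ₒ (f-least ap) p′≢p
              -- `f c` comes no later than `p′`, hence before `p`, so `a` covers it too and it is
              -- the meet of `a` and `c`.
              fc≡p′ : f c ≡ p′
              fc≡p′ = ∧-ac (agree (≤-<-trans (f-least cp′) p′<p) c-fc) c-fc
                where
                c-fc : c ⋗ f c
                c-fc = f-⋗ (⋗⇒≢v₀ cp′)
              fy≡z : f y ≡ z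
              fy≡z = meet-unique cp′ cy p′≢y
                (subst (_⋗ f y) fc≡p′ (IH c<N cy y≢v₀)) (f-⋗ y≢v₀) p′z yz
              ph : p ⋗ h
              ph = f-⋗ p≢v₀
              p′h : p′ ⋗ h
              p′h = IH a<N ap p≢v₀
              p⋗̸z : ¬ p ⋗ z
              p⋗̸z pz = no-common-lower a-p′ ap ax p′≢p (<ₒ⇒≢ p<x) (≢-sym (<ₒ⇒≢ (<-trans p′<p p<x)))
                p′z pz xz
              -- Equality would put `z` below `p`, and so below the three lower neighbours `p′`,
              -- `p`, `x` of `a`.
              h<z : h <ₒ z
              h<z = ≤ₒ∧≢⇒<ₒ
                (subst (h ≤ₒ_) fy≡z (f-mono p<y (⋗-level² ta ap tb by) y≢v₀))
                (λ h≡z → p⋗̸z (subst (p ⋗_) h≡z ph))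

              with-r : ∃ (λ r → p ⋗ r × x ⋗ r) → ⊥
              with-r (r , pr , xr) =
                with-s (first-difference y<x (⋗-levelˡ by bx) xr y⋗̸r)
                where
                y⋗̸r : ¬ y ⋗ r
                y⋗̸r yr = p⋗̸z (subst (p ⋗_) (meet-unique by bx y≢x yr xr yz xz) pr)

                with-s : ∃ (λ s → y ⋗ s × ¬ x ⋗ s × s <ₒ r × (∀ {m} → m <ₒ s → x ⋗ m → y ⋗ m)) → ⊥
                with-s (s , ys , x⋗̸s , s<r , _) = by-parents (f s ≟ f r)
                  where
                  s≢r : s ≢ r
                  s≢r = <ₒ⇒≢ s<r
                  lv-s≡r : lv s ≡ lv r
                  lv-s≡r = ⋗-level² by ys bx xr
                  s≢v₀ : s ≢ v₀
                  s≢v₀ = ≢⇒≢v₀ s≢r lv-s≡r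
                  r≢v₀ : r ≢ v₀
                  r≢v₀ = ≢⇒≢v₀ (≢-sym s≢r) (sym lv-s≡r)
                  s-fs : s ⋗ f s
                  s-fs = f-⋗ s≢v₀
                  h-fr : h ⋗ f r
                  h-fr = IH (below a<N ap) pr r≢v₀
                  p′⋗̸s : ¬ p′ ⋗ s
                  p′⋗̸s p′s =
                    x⋗̸s (subst (x ⋗_) (meet-unique cp′ cy p′≢y p′z yz p′s ys) xz)

                  -- Agreement before `p` makes `a` cover `m`, so `m` is the meet `p′` of `a` and
                  -- `c`, which does not cover `s`. Both cases for the parents of `s` and `r` rest
                  -- on this.
                  no-early : ∀ {m} → c ⋗ m → m ⋗ s → ¬ m <ₒ p
                  no-early cm ms m<p = p′⋗̸s (subst (_⋗ s) (∧-ac (agree m<p cm) cm) ms)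

                  by-parents : Dec (f s ≡ f r) → ⊥
                  by-parents (no fs≢fr) =
                    descent _ refl (below a<N a-p′) p′h p′z h-fr z-fr z-fs h<z fs<fr none
                    where
                    z-fr : z ⋗ f r
                    z-fr = IH (below b<N bx) xr r≢v₀
                    z-fs : z ⋗ f s
                    z-fs = subst (_⋗ f s) fy≡z (IH (below b<N by) ys s≢v₀)
                    fs<fr : f s <ₒ f r
                    fs<fr = ≤ₒ∧≢⇒<ₒ (f-mono s<r lv-s≡r r≢v₀) fs≢fr
                    -- A forbidden `k` lifts to `m` between `c` and `s`; its parent is no later than
                    -- `k`, so `m` would precede `p`.
                    none : ∀ {k} → p′ ⋗ k → k ⋗ f s → ¬ k <ₒ h
                    none {k} p′k k-fs k<h =
                      let m , cm , mk , ms = join cp′ p′k cy ys k-fs s-fs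
                            (λ k≡s → p′⋗̸s (subst (p′ ⋗_) k≡s p′k))
                      in no-early cm ms (f-reflect-< (≤-<-trans (f-least mk) k<h)
                           (⋗-level² tc cm ta ap) (⋗⇒≢v₀ mk))
                  by-parents (yes fs≡fr) =
                    with-q (join by ys bx xr s-fs r-fs s≢r)
                    where
                    r-fs : r ⋗ f s
                    r-fs = subst (r ⋗_) (sym fs≡fr) (f-⋗ r≢v₀)
                    h-fs : h ⋗ f s
                    h-fs = subst (h ⋗_) (sym fs≡fr) h-fr

                    with-q : ∃ (λ q → b ⋗ q × q ⋗ s × q ⋗ r) → ⊥
                    with-q (q , bq , qs , qr) = with-e (join ta ap tb bq pr qr p≢q)
                      where
                      p≢q : p ≢ q
                      p≢q refl = x⋗̸s (subst (_⋗ s) (meet-unique ta tb a≢b ap bq ax bx) qs)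
                      q≢v₀ : q ≢ v₀
                      q≢v₀ = ⋗⇒≢v₀ qs
                      -- By the induction hypothesis `y` covers `f q`, so `f q` is the meet of `y`
                      -- and `q`.
                      fq≡s : f q ≡ s
                      fq≡s = meet-unique by bq (λ y≡q → y⋗̸r (subst (_⋗ r) (sym y≡q) qr))
                        (IH b<N bq q≢v₀) (f-⋗ q≢v₀) ys qs

                      with-e : ∃ (λ e → t ⋗ e × e ⋗ p × e ⋗ q) → ⊥
                      with-e (e , te , ep , eq) = no-early c-fe fe-s fe<p
                        where
                        fe-s : f e ⋗ s
                        fe-s = subst (f e ⋗_) fq≡s (IH (lower-<N lt te) eq q≢v₀)
                        fe-h : f e ⋗ h
                        fe-h = IH (lower-<N lt te) ep p≢v₀
                        -- If `f e` were `p`, then `s` would be a second meet of `p` and `q` besides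
                        -- `r`.
                        fe<p : f e <ₒ p
                        fe<p = ≤ₒ∧≢⇒<ₒ (f-least ep)
                          (λ fe≡p → s≢r (meet-unique ep eq p≢q (subst (_⋗ s) fe≡p fe-s) qs pr qr))
                        h≢s : h ≢ s
                        h≢s h≡s = p′⋗̸s (subst (p′ ⋗_) h≡s p′h)
                        -- `c` covers a join of `h` and `s`; `f e` is also a join of them, and joins
                        -- over the common lower neighbour `f s` are unique.
                        c-fe : c ⋗ f e
                        c-fe = let m , cm , mh , ms = join cp′ p′h cy ys h-fs s-fs h≢s in
                          subst (c ⋗_) (join-unique mh ms fe-h fe-s h-fs s-fs h≢s) cm

        parents-⋗ₙ : ∀ {t b} → lv t ≡ N → t ⋗ b → b ≢ v₀ → f t ⋗ f b
        parents-⋗ₙ {t} {b} lt tb b≢v₀ with f t ≟ b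
        ... | yes a≡b = subst (_⋗ f b) (sym a≡b) (f-⋗ b≢v₀)
        ... | no a≢b with meet (f-⋗ (⋗⇒≢v₀ tb)) tb a≢b
        ...   | x , ax , bx with f b ≟ x
        ...     | yes y≡x = subst (f t ⋗_) (sym y≡x) ax
        ...     | no y≢x = contradiction y≢x (meet-is-parent lt tb a≢b ax bx)

      -- Induction over levels and conclusion

      parents-⋗ : ∀ {x y} → x ⋗ y → y ≢ v₀ → f x ⋗ f y
      parents-⋗ {x} = up-to (suc (lv x)) (n<1+n (lv x))
        where
        up-to : ∀ k {x y} → lv x < k → x ⋗ y → y ≢ v₀ → f x ⋗ f y
        up-to (suc k) (s≤s x≤k) xy y≢v₀ with m≤n⇒m<n∨m≡n x≤k
        ... | inj₁ x<k = up-to k x<k xy y≢v₀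
        -- At level exactly `k`, the recursive call `up-to k` is the induction hypothesis for all
        -- levels below `k`.
        ... | inj₂ x≡k = Step.parents-⋗ₙ k (up-to k) x≡k xy y≢v₀

theorem4p5 : (G : Graph) → Graph.Connected G → Graph.IsMedian G →
    (v₀ : Fin (Graph.n G)) → (pos : Fin (Graph.n G) → Fin (Graph.n G)) →
    Graph.BFS.IsLexBFS G v₀ pos →
    (f : Fin (Graph.n G) → Fin (Graph.n G)) →
    (∀ v → v ≢ v₀ → Graph.BFS.IsParent G v₀ pos (f v) v) →
    ∀ u v → Graph._~_ G u v → u ≢ v₀ → v ≢ v₀ →
    Graph._~_ G (f u) (f v)
theorem4p5 G _ med v₀ pos lexBFS f parent u v uv u≢v₀ v≢v₀ = by-level (<-cmp (lv u) (lv v))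
  where
  open Graph G using (_~_; ~-sym)
  open Median G med
  open Levels v₀
  open LexBFS pos lexBFS f parent

  by-level : Tri (lv u < lv v) (lv u ≡ lv v) (lv v < lv u) → f u ~ f v
  by-level (tri< u<v _ _) = ~-sym (proj₁ (parents-⋗ (~⇒⋗ (~-sym uv) u<v) u≢v₀))
  by-level (tri≈ _ u≡v _) = contradiction uv (same-level⇒≁ u≡v)
  by-level (tri> _ _ v<u) = proj₁ (parents-⋗ (~⇒⋗ uv v<u) v≢v₀)
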